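{- There exists an $N$-node graph such that any embedding of it into an $N$-node $2$-dimensional grid with edge-congestion $1$ has a dilation of $\Theta(N)$.
   Context: Write $[\ell]=\{1,\ldots,\ell\}$. A $2$-dimensional grid is, for positive integers $\ell_1,\ell_2$, the graph with node set $[\ell_1]\times[\ell_2]$ in which two nodes are adjacent iff they differ by exactly $1$ in one coordinate and agree in the other; it is an $N$-node grid if $\ell_1\ell_2=N$. An embedding of a graph $G$ into a graph $H$ is a pair $\langle\phi,\rho\rangle$ where $\phi$ is a one-to-one mapping from the nodes of $G$ to the nodes of $H$ and $\rho$ maps each edge $(u,v)$ of $G$ (identified with the pair $(\phi(u),\phi(v))$) onto a set of edges of $H$ inducing a path connecting $\phi(u)$ and $\phi(v)$. The dilation of the embedding is the maximum, over edges of $G$, of the number of edges in the assigned path. The edge-congestion of the embedding is the maximum, over edges $e'$ of $H$, of the number of edges of $G$ whose assigned path contains $e'$. -}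

module Defs where

open import Data.Fin using (Fin; toℕ)
import Data.Fin as Fin
import Data.Fin.Properties as Fin
open import Data.List using (List; []; _∷_; length; map; filter; allFin; cartesianProduct; lookup)
open import Data.List.Extrema.Nat using (max)
open import Data.List.Membership.Propositional using (_∈_)
import Data.List.Membership.DecPropositional as DecMembership
open import Data.List.Relation.Unary.Unique.Propositional using (Unique)
open import Data.Nat using (ℕ; _*_; ∣_-_∣; NonZero)
import Data.Nat as ℕ
open import Data.Nat.Properties using (∣n-n∣≡0; ∣-∣-comm)
open import Data.Product using (Σ; _×_; _,_; proj₁; proj₂; swap)
open import Data.Product.Properties using (≡-dec)
open import Data.Sum using (_⊎_; inj₁; inj₂)
open import Function using (Injective; _↔_; Inverse)
open import Function.Construct.Symmetry using (↔-sym)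
open import Function.Properties.Inverse using (↔⇒↣)
open import Level using (0ℓ)
open import Relation.Binary using (Rel; Decidable; DecidableEquality; Symmetric)
open import Relation.Binary.Construct.Closure.ReflexiveTransitive using (Star; ε; _◅_)
open import Relation.Binary.PropositionalEquality using (_≡_; refl; sym; trans)
open import Relation.Nullary using (¬_; Dec; _×-dec_; _⊎-dec_)
open import Relation.Nullary.Decidable using (via-injection)

-- Finite simple graphs with N nodes.
record Graph (N : ℕ) : Set₁ where
  infix 4 _~_ _~?_ _≟_
  field
    Node     : Set
    index    : Node ↔ Fin N
    _~_      : Rel Node 0ℓ
    _~?_     : Decidable _~_
    ~-sym    : Symmetric _~_
    ~-irrefl : ∀ {u} → ¬ (u ~ u)

  _≟_ : DecidableEquality Node
  _≟_ = via-injection (↔⇒↣ index) Fin._≟_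

  nodes : List Node
  nodes = map (Inverse.from index) (allFin N)

  -- The index only serves to list each unordered edge {u , v} exactly once,
  -- oriented from the smaller index to the larger.
  Oriented : Node × Node → Set
  Oriented (u , v) = Inverse.to index u Fin.< Inverse.to index v × u ~ v

  oriented? : ∀ e → Dec (Oriented e)
  oriented? (u , v) = (Inverse.to index u Fin.<? Inverse.to index v) ×-dec (u ~? v)

  edges : List (Node × Node)
  edges = filter oriented? (cartesianProduct nodes nodes)

  Edge : Set
  Edge = Fin (length edges)

  ends : Edge → Node × Node
  ends = lookup edges

  steps : ∀ {u v} → Star _~_ u v → List (Node × Node)
  steps ε                     = []
  steps (_◅_ {u} {v} _ walk)  = (u , v) ∷ steps walk

  vertices : ∀ {u v} → Star _~_ u v → List Node
  vertices {u} walk = u ∷ map proj₂ (steps walk)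

  Path : Node → Node → Set
  Path u v = Σ (Star _~_ u v) λ walk → Unique (vertices walk)

  -- No edge is repeated on a path, so this is the number of edges.
  pathLength : ∀ {u v} → Path u v → ℕ
  pathLength (walk , _) = length (steps walk)

  -- A path may traverse an edge in either direction.
  Uses : ∀ {u v} → Path u v → Edge → Set
  Uses (walk , _) e = ends e ∈ steps walk ⊎ swap (ends e) ∈ steps walk

  uses? : ∀ {u v} (p : Path u v) (e : Edge) → Dec (Uses p e)
  uses? (walk , _) e = (ends e ∈? steps walk) ⊎-dec (swap (ends e) ∈? steps walk)
    where open DecMembership (≡-dec _≟_ _≟_) using (_∈?_)

-- The nodes are [ℓ₁] × [ℓ₂], with coordinates counted from 0.
module _ (ℓ₁ ℓ₂ : ℕ) where

  GridAdjacent : Rel (Fin ℓ₁ × Fin ℓ₂) 0ℓ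
  GridAdjacent (i , j) (i′ , j′) =
      (∣ toℕ i - toℕ i′ ∣ ≡ 1 × j ≡ j′)
    ⊎ (i ≡ i′ × ∣ toℕ j - toℕ j′ ∣ ≡ 1)

  grid : .{{_ : NonZero ℓ₁}} .{{_ : NonZero ℓ₂}} → Graph (ℓ₁ * ℓ₂)
  grid = record
    { Node     = Fin ℓ₁ × Fin ℓ₂
    ; index    = ↔-sym (Fin.*↔× {ℓ₁} {ℓ₂})
    ; _~_      = GridAdjacent
    ; _~?_     = λ (i , j) (i′ , j′) →
        ((∣ toℕ i - toℕ i′ ∣ ℕ.≟ 1) ×-dec (j Fin.≟ j′))
        ⊎-dec ((i Fin.≟ i′) ×-dec (∣ toℕ j - toℕ j′ ∣ ℕ.≟ 1))
    ; ~-sym    = λ {x} {y} → symmetric x y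
    ; ~-irrefl = λ {x} → irreflexive x
    }
    where
    symmetric : ∀ x y → GridAdjacent x y → GridAdjacent y x
    symmetric (i , j) (i′ , j′) (inj₁ (d , eq)) =
      inj₁ (trans (∣-∣-comm (toℕ i′) (toℕ i)) d , sym eq)
    symmetric (i , j) (i′ , j′) (inj₂ (eq , d)) =
      inj₂ (sym eq , trans (∣-∣-comm (toℕ j′) (toℕ j)) d)

    irreflexive : ∀ x → ¬ GridAdjacent x x
    irreflexive (i , j) (inj₁ (d , _)) with () ← trans (sym (∣n-n∣≡0 (toℕ i))) d
    irreflexive (i , j) (inj₂ (_ , d)) with () ← trans (sym (∣n-n∣≡0 (toℕ j))) d

record Embedding {M N : ℕ} (G : Graph M) (H : Graph N) : Set where
  private
    module G = Graph G
    module H = Graph H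
  field
    φ           : G.Node → H.Node
    φ-injective : Injective _≡_ _≡_ φ
    ρ           : (e : G.Edge) → H.Path (φ (proj₁ (G.ends e))) (φ (proj₂ (G.ends e)))

  dilation : ℕ
  dilation = max 0 (map (λ e → H.pathLength (ρ e)) (allFin (length G.edges)))

  congestionAt : H.Edge → ℕ
  congestionAt e′ = length (filter (λ e → H.uses? (ρ e) e′) (allFin (length G.edges)))

  edgeCongestion : ℕ
  edgeCongestion = max 0 (map congestionAt (allFin (length H.edges)))

{-# OPTIONS --safe #-}

-- The graph for N = 2p, p prime, lives on a 2 × p grid: a 4-cycle on the two leftmost
-- columns, another on the two rightmost ones, the top row joining them, and one long edge
-- joining their bottom inner corners; the other nodes are isolated.  The bottom row is free
-- to carry the long edge, so congestion 1 is possible.  As p is prime, any grid with 2p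
-- nodes has a side of length at most 2, so a cut between consecutive columns of the host
-- has at most two edges and is crossed by at most two edges of the graph.
--
-- Write a, a′ for the inner corners of the left cycle, x, x′ for the outer ones, and b, b′
-- for the inner corners of the right cycle.  Three edge-disjoint paths join a to a′, which
-- therefore share a column, and likewise b and b′.  If a is placed to the left of b, no top
-- node c between them can be to the left of a: the cut before a would be crossed by an edge
-- of the a–c path and one of the c–b path, so x and x′ would not be before a, hence
-- strictly after it, its column being full; but then xa, x′a′ and a′b′ cross the cut after a.
-- By symmetry all p − 2 such nodes lie between the columns of a and b, so the long
-- edge a′b′ is stretched over about p/2 columns.

module Submission where

open import Defs
import Algebra.Properties.CommutativeSemigroup as CommutativeSemigroupProperties
open import Data.Bool using (Bool; true; false)
import Data.Bool.Properties as Bool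
open import Data.Empty using (⊥; ⊥-elim)
open import Data.Fin using (Fin; zero; suc; toℕ; fromℕ<; opposite; inject≤; combine)
open import Data.Fin.Patterns using (0F; 1F)
import Data.Fin.Properties as Fin
open import Data.Integer as ℤ using (+_)
import Data.Integer.Properties as ℤ
open import Data.List using (List; []; _∷_; length; map; filter; allFin; cartesianProduct; lookup)
open import Data.List.Extrema.Nat using (max; max≤v⁺; xs≤max)
open import Data.List.Membership.Propositional using (_∈_)
open import Data.List.Membership.Propositional.Properties
  using (∈-lookup; ∈-filter⁺; ∈-filter⁻; ∈-allFin; ∈-map⁺; ∈-cartesianProduct⁺)
open import Data.List.Properties using (length-map; length-filter; length-tabulate)
open import Data.List.Relation.Unary.All as All using (All; []; _∷_)
import Data.List.Relation.Unary.All.Properties as All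
open import Data.List.Relation.Unary.AllPairs using ([]; _∷_)
open import Data.List.Relation.Unary.Any as Any using (here; there)
open import Data.List.Relation.Unary.Any.Properties using (lookup-index)
open import Data.List.Relation.Unary.Unique.Propositional using (Unique)
import Data.List.Relation.Unary.Unique.Propositional.Properties as Unique
open import Data.Nat as ℕ
  using (ℕ; zero; suc; _+_; _*_; _∸_; _!; _≤_; _<_; z≤n; s≤s; ∣_-_∣; NonZero)
open import Data.Nat.Divisibility
  using (_∣_; divides; ∣-trans; m∣m*n; m≤n⇒m!∣n!; ∣m+n∣m⇒∣n; ∣1⇒≡1; ∣⇒≤)
open import Data.Nat.DivMod using (m*n/n≡m)
open import Data.Nat.ListAction using (product)
open import Data.Nat.Primality using (Prime; prime?; ¬prime[1]; prime⇒nonZero; euclidsLemma)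
open import Data.Nat.Primality.Factorisation using (factorise; module PrimeFactorisation)
import Data.Nat.Properties as ℕ
open import Data.Product using (Σ; ∃; ∃₂; _×_; _,_; proj₁; proj₂; swap; map₂)
open import Data.Rational as ℚ using (ℚ; 0ℚ; 1ℚ; _/_)
import Data.Rational.Properties as ℚ
open import Data.Rational.Unnormalised using (mkℚᵘ; *≤*; *≡*)
import Data.Rational.Unnormalised.Properties as ℚᵘ
open import Data.Sum as Sum using (_⊎_; inj₁; inj₂; [_,_]′)
open import Function using (_∘_; case_of_; Injective; Inverse)
open import Function.Construct.Identity using (↔-id)
open import Level using (0ℓ)
open import Relation.Binary using (Rel; Decidable; tri<; tri≈; tri>)
open import Relation.Binary.Construct.Closure.ReflexiveTransitive using (Star; ε; _◅_)
open import Relation.Binary.PropositionalEquality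
open import Relation.Nullary using (¬_; Dec; yes; no; does; contradiction; _×-dec_; _⊎-dec_)
open import Relation.Nullary.Decidable using (dec-true; dec-false; decidable-stable; map′)
open Embedding using (φ; φ-injective; ρ; dilation; congestionAt; edgeCongestion)

-- Auxiliary facts on lists and maxima.

∣n-1+n∣≡1 : ∀ n → ∣ n - suc n ∣ ≡ 1
∣n-1+n∣≡1 zero    = refl
∣n-1+n∣≡1 (suc n) = ∣n-1+n∣≡1 n

module _ {A : Set} where

  lookup-injective : ∀ {xs : List A} → Unique xs → Injective _≡_ _≡_ (lookup xs)
  lookup-injective (x∉ ∷ xs!) {zero}  {zero}  eq = refl
  lookup-injective (x∉ ∷ xs!) {zero}  {suc j} eq = ⊥-elim (All.lookup x∉ (∈-lookup j) eq)
  lookup-injective (x∉ ∷ xs!) {suc i} {zero}  eq = ⊥-elim (All.lookup x∉ (∈-lookup i) (sym eq))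
  lookup-injective (x∉ ∷ xs!) {suc i} {suc j} eq = cong suc (lookup-injective xs! eq)

  ∈⇒0<length : ∀ {x} {xs : List A} → x ∈ xs → 0 < length xs
  ∈⇒0<length (here _)  = s≤s z≤n
  ∈⇒0<length (there _) = s≤s z≤n

  length≤1⇒≡ : ∀ {x y} {xs : List A} → length xs ≤ 1 → x ∈ xs → y ∈ xs → x ≡ y
  length≤1⇒≡ _       (here refl) (here refl) = refl
  length≤1⇒≡ (s≤s l) (here _)    (there q)   = contradiction l (ℕ.<⇒≱ (∈⇒0<length q))
  length≤1⇒≡ (s≤s l) (there p)   _           = contradiction l (ℕ.<⇒≱ (∈⇒0<length p))

  ≡⇒length≤1 : ∀ {xs : List A} → Unique xs → (∀ {x y} → x ∈ xs → y ∈ xs → x ≡ y) → length xs ≤ 1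
  ≡⇒length≤1 []                     _  = z≤n
  ≡⇒length≤1 (_ ∷ [])               _  = ℕ.≤-refl
  ≡⇒length≤1 ((x≢y ∷ _) ∷ (_ ∷ _)) eq = contradiction (eq (here refl) (there (here refl))) x≢y

module _ {k : ℕ} (f : Fin k → ℕ) where

  max-allFin≤ : ∀ {m} → (∀ i → f i ≤ m) → max 0 (map f (allFin k)) ≤ m
  max-allFin≤ f≤m = max≤v⁺ z≤n (All.map⁺ (All.universal f≤m (allFin k)))

  ≤max-allFin : ∀ i → f i ≤ max 0 (map f (allFin k))
  ≤max-allFin i = All.lookup (xs≤max 0 (map f (allFin k))) (∈-map⁺ f (∈-allFin i))

-- Edge lists, path lengths and congestion.

module GraphProperties {N : ℕ} (G : Graph N) where
  open Graph G
  open Inverse index using (to; from; strictlyInverseʳ)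

  Joins : Edge → Node → Node → Set
  Joins e u v = ends e ≡ (u , v) ⊎ ends e ≡ (v , u)

  to-injective : Injective _≡_ _≡_ to
  to-injective {u} {v} eq =
    trans (sym (strictlyInverseʳ u)) (trans (cong from eq) (strictlyInverseʳ v))

  from-injective : Injective _≡_ _≡_ from
  from-injective {i} {j} eq =
    trans (sym (Inverse.strictlyInverseˡ index i)) (trans (cong to eq) (Inverse.strictlyInverseˡ index j))

  edges-unique : Unique edges
  edges-unique = Unique.filter⁺ oriented? (Unique.cartesianProduct⁺ nodes! nodes!)
    where
    nodes! : Unique nodes
    nodes! = Unique.map⁺ from-injective (Unique.allFin⁺ N)

  ends-injective : Injective _≡_ _≡_ ends
  ends-injective = lookup-injective edges-unique

  ends-oriented : ∀ e → Oriented (ends e)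
  ends-oriented e = proj₂ (∈-filter⁻ oriented? {xs = cartesianProduct nodes nodes} (∈-lookup {xs = edges} e))

  oriented-edge : ∀ {u v} → Oriented (u , v) → ∃ λ e → ends e ≡ (u , v)
  oriented-edge {u} {v} o = Any.index m , sym (lookup-index m)
    where
    ∈-nodes : ∀ w → w ∈ nodes
    ∈-nodes w = subst (_∈ nodes) (strictlyInverseʳ w) (∈-map⁺ from (∈-allFin (to w)))

    m : (u , v) ∈ edges
    m = ∈-filter⁺ oriented? (∈-cartesianProduct⁺ (∈-nodes u) (∈-nodes v)) o

  edge-between : ∀ {u v} → u ~ v → ∃ λ e → Joins e u v
  edge-between {u} {v} u~v with Fin.<-cmp (to u) (to v)
  ... | tri< lt _ _ = let e , eq = oriented-edge (lt , u~v) in e , inj₁ eq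
  ... | tri≈ _ eq _ = ⊥-elim (~-irrefl (subst (u ~_) (sym (to-injective eq)) u~v))
  ... | tri> _ _ gt = let e , eq = oriented-edge (gt , ~-sym u~v) in e , inj₂ eq

  -- The nodes of a path are distinct, so their indices embed its vertex list into `Fin N`. This
  -- gives the upper half of the Θ bound.
  pathLength<N : ∀ {u v} (p : Path u v) → pathLength p < N
  pathLength<N (walk , unique) = begin
    suc (length (steps walk))         ≡⟨ cong suc (length-map proj₂ (steps walk)) ⟨
    length (vertices walk)            ≡⟨ length-map to (vertices walk) ⟨
    length (map to (vertices walk))   ≤⟨ Fin.injective⇒≤ (lookup-injective (Unique.map⁺ to-injective unique)) ⟩
    N                                 ∎
    where open ℕ.≤-Reasoning

module EmbeddingProperties {M N : ℕ} {G : Graph M} {H : Graph N} (E : Embedding G H) where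
  private
    module G = Graph G
    module H = Graph H

  dilation≤N : dilation E ≤ N
  dilation≤N = max-allFin≤ (λ e → H.pathLength (ρ E e))
    λ e → ℕ.<⇒≤ (GraphProperties.pathLength<N H (ρ E e))

  pathLength≤dilation : ∀ e → H.pathLength (ρ E e) ≤ dilation E
  pathLength≤dilation = ≤max-allFin (λ e → H.pathLength (ρ E e))

  users : H.Edge → List G.Edge
  users e′ = filter (λ e → H.uses? (ρ E e) e′) (allFin _)

  ∈-users : ∀ {e e′} → H.Uses (ρ E e) e′ → e ∈ users e′
  ∈-users {e} {e′} use = ∈-filter⁺ (λ e → H.uses? (ρ E e) e′) (∈-allFin e) use

  congestion≤1⇒≡ : edgeCongestion E ≡ 1 →
    ∀ {e₁ e₂} e′ → H.Uses (ρ E e₁) e′ → H.Uses (ρ E e₂) e′ → e₁ ≡ e₂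
  congestion≤1⇒≡ cong1 e′ use₁ use₂ = length≤1⇒≡
    (subst (congestionAt E e′ ≤_) cong1
      (≤max-allFin (congestionAt E) e′))
    (∈-users use₁) (∈-users use₂)

  -- The first assumption bounds every congestion by 1. The second exhibits a host edge in use and
  -- so excludes the value 0.
  ≡⇒congestion≡1 :
    (∀ {e₁ e₂} e′ → H.Uses (ρ E e₁) e′ → H.Uses (ρ E e₂) e′ → e₁ ≡ e₂) →
    (∃₂ λ e e′ → H.Uses (ρ E e) e′) → edgeCongestion E ≡ 1
  ≡⇒congestion≡1 same (e₀ , e₀′ , use₀) = ℕ.≤-antisym
    (max-allFin≤ (congestionAt E) atMost1)
    (ℕ.≤-trans (∈⇒0<length (∈-users use₀))
      (≤max-allFin (congestionAt E) e₀′))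
    where
    atMost1 : ∀ e′ → congestionAt E e′ ≤ 1
    atMost1 e′ = ≡⇒length≤1 (Unique.filter⁺ (λ e → H.uses? (ρ E e) e′) (Unique.allFin⁺ _))
      λ p q → same e′ (user p) (user q)
      where
      user : ∀ {e} → e ∈ users e′ → H.Uses (ρ E e) e′
      user p = proj₂ (∈-filter⁻ (λ e → H.uses? (ρ E e) e′) {xs = allFin _} p)

  edgeless⇒congestion≡0 : ¬ G.Edge → edgeCongestion E ≡ 0
  edgeless⇒congestion≡0 edgeless = ℕ.n≤0⇒n≡0 (max-allFin≤ (congestionAt E) none)
    where
    none : ∀ e′ → congestionAt E e′ ≤ 0
    none e′ = begin
      length (users e′)                      ≤⟨ length-filter _ (allFin (length G.edges)) ⟩
      length (allFin (length G.edges))       ≡⟨ length-tabulate _ ⟩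
      length G.edges                         ≤⟨ Fin.injective⇒≤ {f = λ e → ⊥-elim (edgeless e)} (λ {e} _ → ⊥-elim (edgeless e)) ⟩
      0                                      ∎
      where open ℕ.≤-Reasoning

-- Straight paths along a grid row.

record StraightPath {ℓ₁ ℓ₂ : ℕ} .{{_ : NonZero ℓ₁}} .{{_ : NonZero ℓ₂}}
                    (i : Fin ℓ₁) (j j′ : Fin ℓ₂) : Set where
  open Graph (grid ℓ₁ ℓ₂)
  field
    walk            : Star _~_ (i , j) (i , j′)
    unique          : Unique (vertices walk)
    vertices-right  : All (λ v → toℕ j ≤ toℕ (proj₂ v)) (vertices walk)
    steps-straight  : All (λ ((i₁ , j₁) , (i₂ , j₂)) →
      i₁ ≡ i × i₂ ≡ i × toℕ j₂ ≡ suc (toℕ j₁) × toℕ j ≤ toℕ j₁ × toℕ j₂ ≤ toℕ j′) (steps walk)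

-- Induction on the length `k`. The field `vertices-right` yields `unique`: the node put in front
-- lies strictly to the left of all later ones.
straightPath : ∀ {ℓ₁ ℓ₂} .{{_ : NonZero ℓ₁}} .{{_ : NonZero ℓ₂}} k {i : Fin ℓ₁} {j j′ : Fin ℓ₂} →
  toℕ j + k ≡ toℕ j′ → StraightPath i j j′
straightPath zero {j = j} {j′} eq
  with refl ← Fin.toℕ-injective {i = j} {j = j′} (trans (sym (ℕ.+-identityʳ _)) eq) = record
  { walk           = ε
  ; unique         = [] ∷ []
  ; vertices-right = ℕ.≤-refl ∷ []
  ; steps-straight = []
  }
straightPath {ℓ₁} {ℓ₂} (suc k) {i} {j} {j′} eq = record
  { walk           = inj₂ (refl , trans (cong (∣ toℕ j -_∣) toℕ-next) (∣n-1+n∣≡1 (toℕ j))) ◅ rest.walk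
  ; unique         = All.map (λ next≤ eq → ℕ.<-irrefl (cong (toℕ ∘ proj₂) eq) (next⇒ next≤)) rest.vertices-right
                       ∷ rest.unique
  ; vertices-right = ℕ.≤-refl ∷ All.map (ℕ.<⇒≤ ∘ next⇒) rest.vertices-right
  ; steps-straight = (refl , refl , toℕ-next , ℕ.≤-refl ,
      subst₂ _≤_ (sym toℕ-next) eq′ (ℕ.m≤m+n _ k)) ∷
      All.map (map₂ (map₂ (map₂ λ (next≤ , ≤j′) → ℕ.<⇒≤ (next⇒ next≤) , ≤j′))) rest.steps-straight
  }
  where
  eq′ : suc (toℕ j) + k ≡ toℕ j′
  eq′ = trans (sym (ℕ.+-suc (toℕ j) k)) eq

  bound : suc (toℕ j) < ℓ₂
  bound = ℕ.≤-<-trans (subst (suc (toℕ j) ≤_) eq′ (ℕ.m≤m+n _ k)) (Fin.toℕ<n j′)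

  next : Fin ℓ₂
  next = fromℕ< bound

  toℕ-next : toℕ next ≡ suc (toℕ j)
  toℕ-next = Fin.toℕ-fromℕ< bound

  next⇒ : ∀ {m} → toℕ next ≤ m → toℕ j < m
  next⇒ = subst (_≤ _) toℕ-next

  module rest = StraightPath (straightPath {ℓ₁} k {i} {next} {j′} (trans (cong (_+ k) toℕ-next) eq′))

-- The graph and its embedding with congestion 1 in the two-row grid.

-- m is the index of the last column.
module Clamp (m : ℕ) (11≤m : 11 ≤ m) where

  columns : ℕ
  columns = suc m

  1<columns : 1 < columns
  1<columns = s≤s (ℕ.≤-trans (s≤s z≤n) 11≤m)

  Position : Set
  Position = Fin 2 × Fin columns

  -- The grid edges between kept nodes are exactly the two 4-cycles and the top row. The other
  -- bottom nodes stay isolated.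
  Kept : Position → Set
  Kept (i , j) = i ≡ 0F ⊎ toℕ j ≤ 1 ⊎ toℕ (opposite j) ≤ 1

  -- The long edge directed from left to right; `clampAdjacent` symmetrises it.
  Long : Rel Position 0ℓ
  Long (i , j) (i′ , j′) = (i ≡ 1F × toℕ j ≡ 1) × (i′ ≡ 1F × toℕ (opposite j′) ≡ 1)

  private
    module Grid = Graph (grid 2 columns)

  column+opposite : ∀ (j : Fin columns) → toℕ j + toℕ (opposite j) ≡ m
  column+opposite j =
    trans (cong (toℕ j ℕ.+_) (Fin.opposite-prop j)) (ℕ.m+[n∸m]≡n (Fin.toℕ≤pred[n] j))

  column-opposite≡1 : ∀ (j : Fin columns) → toℕ (opposite j) ≡ 1 → suc (toℕ j) ≡ m
  column-opposite≡1 j eq = begin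
    suc (toℕ j)                 ≡⟨ ℕ.+-comm 1 (toℕ j) ⟩
    toℕ j + 1                   ≡⟨ cong (toℕ j ℕ.+_) eq ⟨
    toℕ j + toℕ (opposite j)    ≡⟨ column+opposite j ⟩
    m                           ∎
    where open ≡-Reasoning

  clampAdjacent : Rel Position 0ℓ
  clampAdjacent u v = (u Grid.~ v × Kept u × Kept v) ⊎ (Long u v ⊎ Long v u)

  Long? : Decidable Long
  Long? (i , j) (i′ , j′) =
    ((i Fin.≟ 1F) ×-dec (toℕ j ℕ.≟ 1)) ×-dec ((i′ Fin.≟ 1F) ×-dec (toℕ (opposite j′) ℕ.≟ 1))

  Kept? : ∀ u → Dec (Kept u)
  Kept? (i , j) = (i Fin.≟ 0F) ⊎-dec ((toℕ j ℕ.≤? 1) ⊎-dec (toℕ (opposite j) ℕ.≤? 1))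

  Long-irrefl : ∀ {u} → ¬ Long u u
  Long-irrefl {_ , j} ((_ , eq) , (_ , eq′)) =
    ℕ.<⇒≱ (ℕ.<-≤-trans (s≤s (s≤s (s≤s z≤n))) 11≤m)
      (ℕ.≤-reflexive (trans (sym (column-opposite≡1 j eq′)) (cong suc eq)))

  clamp : Graph (2 * columns)
  clamp = record
    { Node     = Position
    ; index    = Grid.index
    ; _~_      = clampAdjacent
    ; _~?_     = λ u v → ((u Grid.~? v) ×-dec (Kept? u ×-dec Kept? v)) ⊎-dec (Long? u v ⊎-dec Long? v u)
    ; ~-sym    = λ {u} {v} → λ where
        (inj₁ (u~v , k , k′)) → inj₁ (Grid.~-sym {u} {v} u~v , k′ , k)
        (inj₂ l)              → inj₂ (Sum.swap l)
    ; ~-irrefl = λ {u} → λ where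
        (inj₁ (u~u , _))  → Grid.~-irrefl {u} u~u
        (inj₂ (inj₁ l))   → Long-irrefl {u} l
        (inj₂ (inj₂ l))   → Long-irrefl {u} l
    }

  private
    module C where
      open Graph clamp public
      open GraphProperties clamp public

  -- The index increases from left to right within a row, so the edge list contains the long edge
  -- only in its left-to-right direction.
  Long-oriented : ∀ {u v} → Long u v → ¬ C.Oriented (v , u)
  Long-oriented {i , j} {i′ , j′} ((refl , eq) , (refl , eq′)) (lt , _) =
    contradiction
      (ℕ.+-cancelˡ-< (columns * 1) _ _
        (subst₂ _<_ (Fin.toℕ-combine i′ j′) (Fin.toℕ-combine i j) lt))
      (ℕ.≤⇒≯ (ℕ.s≤s⁻¹ (subst₂ _≤_ (cong suc (sym eq)) (sym (column-opposite≡1 j′ eq′)) 2≤m)))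
    where
    2≤m : 2 ≤ m
    2≤m = ℕ.≤-trans (s≤s (s≤s z≤n)) 11≤m

  Long-deterministic : ∀ {u v u′ v′} → Long u v → Long u′ v′ → (u , v) ≡ (u′ , v′)
  Long-deterministic {_ , j} {_ , k} {_ , j′} {_ , k′}
    ((refl , a) , (refl , b)) ((refl , a′) , (refl , b′)) = cong₂ (λ j k → (1F , j) , (1F , k))
      (Fin.toℕ-injective (trans a (sym a′)))
      (Fin.toℕ-injective (ℕ.suc-injective
        (trans (column-opposite≡1 k b) (sym (column-opposite≡1 k′ b′)))))

  -- The dichotomy behind disjointness: a short edge is routed along itself, between kept nodes,
  -- whereas each step of the long route has an end that is not kept.
  data Route : Position → Position → List (Position × Position) → Set where
    short : ∀ {u v} → Kept u → Kept v → Route u v ((u , v) ∷ [])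
    long  : ∀ {u v ss} → Long u v →
            All (λ (x , y) → ¬ (Kept x × Kept y)) ss → Route u v ss

  -- The right node is in column 2 or later, hence off the left cycle, and the left node is in
  -- column m - 2 or earlier, hence off the right one. Both kept would join column 1 directly to the
  -- right cycle, which is too far away.
  not-both-kept : ∀ {j₁ j₂ : Fin columns} → toℕ j₂ ≡ suc (toℕ j₁) →
    1 ≤ toℕ j₁ → suc (toℕ j₂) ≤ m → ¬ (Kept (1F , j₁) × Kept (1F , j₂))
  not-both-kept {j₁} {j₂} eq 1≤ 1+j₂≤m (k₁ , k₂) = excluded k₁ k₂
    where
    not-near : ∀ j → 2 + toℕ j ≤ m → ¬ (toℕ (opposite j) ≤ 1)
    not-near j 2+j≤m o≤1 = ℕ.1+n≰n (begin
      2 + toℕ j                 ≤⟨ 2+j≤m ⟩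
      m                         ≡⟨ column+opposite j ⟨
      toℕ j + toℕ (opposite j)  ≤⟨ ℕ.+-monoʳ-≤ (toℕ j) o≤1 ⟩
      toℕ j + 1                 ≡⟨ ℕ.+-comm (toℕ j) 1 ⟩
      1 + toℕ j                 ∎)
      where open ℕ.≤-Reasoning

    excluded : Kept (1F , j₁) → Kept (1F , j₂) → ⊥
    excluded (inj₂ (inj₂ o)) _ = not-near j₁ (subst (λ j → suc j ≤ m) eq 1+j₂≤m) o
    excluded (inj₂ (inj₁ j₁≤1)) (inj₂ (inj₁ j₂≤1)) =
      ℕ.<⇒≱ (s≤s 1≤) (subst (_≤ 1) eq j₂≤1)
    excluded (inj₂ (inj₁ j₁≤1)) (inj₂ (inj₂ o)) = not-near j₂
      (subst (λ j → 2 + j ≤ m) (sym eq)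
        (ℕ.≤-trans (s≤s (s≤s (s≤s j₁≤1))) (ℕ.≤-trans (s≤s (s≤s (s≤s (s≤s z≤n)))) 11≤m)))
      o

  longWalk : ∀ {u v} → Long u v → Σ (Grid.Path u v) λ p → Route u v (Grid.steps (proj₁ p))
  longWalk {_ , j} {_ , j′} l@((refl , eq) , (refl , eq′)) =
    (path.walk , path.unique) ,
    long l (All.map (λ where
      (refl , refl , j₂≡ , ≤j₁ , j₂≤) →
        not-both-kept j₂≡ (subst (_≤ _) eq ≤j₁)
          (ℕ.≤-trans (s≤s j₂≤) (ℕ.≤-reflexive (column-opposite≡1 j′ eq′))))
      path.steps-straight)
    where
    -- The long edge runs from column 1 to column m - 1.
    apart : toℕ j + (m ∸ 2) ≡ toℕ j′
    apart = ℕ.suc-injective (begin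
      suc (toℕ j + (m ∸ 2))  ≡⟨ cong (λ k → suc (k + (m ∸ 2))) eq ⟩
      2 + (m ∸ 2)            ≡⟨ ℕ.m+[n∸m]≡n (ℕ.≤-trans (s≤s (s≤s z≤n)) 11≤m) ⟩
      m                      ≡⟨ column-opposite≡1 j′ eq′ ⟨
      suc (toℕ j′)           ∎)
      where open ≡-Reasoning

    module path = StraightPath {2} {columns} (straightPath (m ∸ 2) {1F} {j} {j′} apart)

  route : ∀ e → let u , v = C.ends e in Σ (Grid.Path u v) λ p → Route u v (Grid.steps (proj₁ p))
  route e = go _ _ (C.ends-oriented e)
    where
    go : ∀ u v → C.Oriented (u , v) → Σ (Grid.Path u v) λ p → Route u v (Grid.steps (proj₁ p))
    go u v (_ , inj₁ (u~v , k , k′)) =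
      (u~v ◅ ε , ((λ { refl → Grid.~-irrefl {u} u~v }) ∷ []) ∷ [] ∷ []) , short k k′
    go u v (_ , inj₂ (inj₁ l)) = longWalk l
    go u v o@(_ , inj₂ (inj₂ l)) = ⊥-elim (Long-oriented l o)

  clampEmbedding : Embedding clamp (grid 2 columns)
  clampEmbedding = record
    { φ           = λ u → u
    ; φ-injective = λ eq → eq
    ; ρ           = λ e → proj₁ (route e)
    }

  oriented-asym : ∀ {u v} → C.Oriented (u , v) → ¬ C.Oriented (v , u)
  oriented-asym (lt , _) (gt , _) = ℕ.<-asym lt gt

  -- A grid edge with both ends kept can carry only the graph edge it coincides with; any other grid
  -- edge can carry only the long edge. The first edge of the top row witnesses that some grid edge
  -- is used.
  clampEmbedding-congestion : edgeCongestion clampEmbedding ≡ 1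
  clampEmbedding-congestion = ≡⇒congestion≡1 shared (e₀ , used)
    where
    open EmbeddingProperties clampEmbedding

    Kind : Position × Position → Position × Position → Set
    Kind s (u , v) = (Kept u × Kept v × (s ≡ (u , v) ⊎ s ≡ (v , u)))
                   ⊎ (Long u v × ¬ (Kept (proj₁ s) × Kept (proj₂ s)))

    kind : ∀ {s u v ss} → Route u v ss → s ∈ ss ⊎ swap s ∈ ss → Kind s (u , v)
    kind (short k k′) (inj₁ (here refl)) = inj₁ (k , k′ , inj₁ refl)
    kind (short k k′) (inj₂ (here refl)) = inj₁ (k , k′ , inj₂ refl)
    kind (long l free) (inj₁ s∈) = inj₂ (l , All.lookup free s∈)
    kind (long l free) (inj₂ s∈) = inj₂ (l , All.lookup free s∈ ∘ swap)

    kept-ends : ∀ {s u v} → Kept u → Kept v → s ≡ (u , v) ⊎ s ≡ (v , u) →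
                Kept (proj₁ s) × Kept (proj₂ s)
    kept-ends k k′ (inj₁ refl) = k , k′
    kept-ends k k′ (inj₂ refl) = k′ , k

    same : ∀ {s d d′} → C.Oriented d → C.Oriented d′ → Kind s d → Kind s d′ → d ≡ d′
    same o o′ (inj₁ (_ , _ , inj₁ refl)) (inj₁ (_ , _ , inj₁ refl)) = refl
    same o o′ (inj₁ (_ , _ , inj₁ refl)) (inj₁ (_ , _ , inj₂ refl)) = ⊥-elim (oriented-asym o o′)
    same o o′ (inj₁ (_ , _ , inj₂ refl)) (inj₁ (_ , _ , inj₁ refl)) = ⊥-elim (oriented-asym o o′)
    same o o′ (inj₁ (_ , _ , inj₂ refl)) (inj₁ (_ , _ , inj₂ refl)) = refl
    same o o′ (inj₁ (k , k′ , eq)) (inj₂ (_ , free)) = ⊥-elim (free (kept-ends k k′ eq))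
    same o o′ (inj₂ (_ , free)) (inj₁ (k , k′ , eq)) = ⊥-elim (free (kept-ends k k′ eq))
    same o o′ (inj₂ (l , _)) (inj₂ (l′ , _)) = Long-deterministic l l′

    shared : ∀ {e₁ e₂} e′ → Grid.Uses (proj₁ (route e₁)) e′ → Grid.Uses (proj₁ (route e₂)) e′ → e₁ ≡ e₂
    shared {e₁} {e₂} e′ use₁ use₂ = C.ends-injective
      (same (C.ends-oriented e₁) (C.ends-oriented e₂)
        (kind (proj₂ (route e₁)) use₁) (kind (proj₂ (route e₂)) use₂))

    v₀ v₁ : Position
    v₀ = 0F , 0F
    v₁ = 0F , fromℕ< 1<columns

    v₀-before-v₁ : toℕ (Inverse.to Grid.index v₀) < toℕ (Inverse.to Grid.index v₁)
    v₀-before-v₁ = subst₂ _<_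
      (sym (Fin.toℕ-combine {2} {columns} 0F 0F)) (sym (Fin.toℕ-combine {2} 0F (proj₂ v₁)))
      (ℕ.+-monoʳ-< (columns * 0) (subst (0 <_) (sym (Fin.toℕ-fromℕ< 1<columns)) (s≤s z≤n)))

    v₀~v₁ : v₀ Grid.~ v₁
    v₀~v₁ = inj₂ (refl , Fin.toℕ-fromℕ< 1<columns)

    clamp-edge : ∃ λ e → C.ends e ≡ (v₀ , v₁)
    clamp-edge = C.oriented-edge (v₀-before-v₁ , inj₁ (v₀~v₁ , inj₁ refl , inj₁ refl))

    grid-edge : ∃ λ e → Grid.ends e ≡ (v₀ , v₁)
    grid-edge = GraphProperties.oriented-edge (grid 2 columns) (v₀-before-v₁ , v₀~v₁)

    e₀ : C.Edge
    e₀ = proj₁ clamp-edge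

    used : ∃ λ e′ → Grid.Uses (proj₁ (route e₀)) e′
    used = proj₁ grid-edge , inj₁ (subst (_∈ Grid.steps (proj₁ (proj₁ (route e₀)))) (sym (proj₂ grid-edge))
             (first (proj₂ clamp-edge) (proj₂ (route e₀))))
      where
      first : ∀ {d ss} → d ≡ (v₀ , v₁) → Route (proj₁ d) (proj₂ d) ss → (v₀ , v₁) ∈ ss
      first refl (short _ _) = here refl
      first refl (long ((() , _) , _) _)

-- Cuts given by a threshold.

≢-split : ∀ {x z : Bool} → x ≢ z → ∀ y → x ≢ y ⊎ y ≢ z
≢-split {x} x≢z y with x Bool.≟ y
... | yes refl = inj₂ x≢z
... | no  x≢y  = inj₁ x≢y

Fin2-pigeonhole : ∀ (r s t : Fin 2) → r ≡ s ⊎ r ≡ t ⊎ s ≡ t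
Fin2-pigeonhole 0F 0F _  = inj₁ refl
Fin2-pigeonhole 0F 1F 0F = inj₂ (inj₁ refl)
Fin2-pigeonhole 0F 1F 1F = inj₂ (inj₂ refl)
Fin2-pigeonhole 1F 0F 0F = inj₂ (inj₂ refl)
Fin2-pigeonhole 1F 0F 1F = inj₂ (inj₁ refl)
Fin2-pigeonhole 1F 1F _  = inj₁ refl

module _ {A : Set} (f : A → ℕ) where

  below : ℕ → A → Bool
  below t v = does (f v ℕ.<? t)

  below-true : ∀ {t v} → f v < t → below t v ≡ true
  below-true {t} {v} = dec-true (f v ℕ.<? t)

  below-false : ∀ {t v} → t ≤ f v → below t v ≡ false
  below-false {t} {v} t≤ = dec-false (f v ℕ.<? t) (ℕ.≤⇒≯ t≤)

  below-false⁻¹ : ∀ {t v} → below t v ≡ false → t ≤ f v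
  below-false⁻¹ eq = ℕ.≮⇒≥ λ lt → case trans (sym (below-true lt)) eq of λ ()

  below-true⁻¹ : ∀ {t v} → below t v ≡ true → f v < t
  below-true⁻¹ eq = ℕ.≰⇒> λ le → case trans (sym eq) (below-false le) of λ ()

  below-separates : ∀ {t u v} → f u < t → t ≤ f v → below t u ≢ below t v
  below-separates lt le eq =
    case trans (sym (below-true lt)) (trans eq (below-false le)) of λ ()

  below-separates⁻¹ : ∀ {t u v} → below t u ≢ below t v →
    (f u < t × t ≤ f v) ⊎ (f v < t × t ≤ f u)
  below-separates⁻¹ {t} {u} {v} sep with f u ℕ.<? t | f v ℕ.<? t
  ... | yes u< | yes v< = ⊥-elim (sep (trans (below-true u<) (sym (below-true v<))))
  ... | yes u< | no  v≮ = inj₁ (u< , ℕ.≮⇒≥ v≮)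
  ... | no  u≮ | yes v< = inj₂ (v< , ℕ.≮⇒≥ u≮)
  ... | no  u≮ | no  v≮ = ⊥-elim (sep (trans (below-false (ℕ.≮⇒≥ u≮)) (sym (below-false (ℕ.≮⇒≥ v≮)))))

  -- If the values differed, the larger one would be a threshold separating the two points.
  below-equal⇒≡ : ∀ {u v} → (∀ t → below t u ≡ below t v) → f u ≡ f v
  below-equal⇒≡ {u} {v} same with ℕ.<-cmp (f u) (f v)
  ... | tri< lt _ _ = ⊥-elim (below-separates lt ℕ.≤-refl (same (f v)))
  ... | tri≈ _ eq _ = eq
  ... | tri> _ _ gt = ⊥-elim (below-separates gt ℕ.≤-refl (sym (same (f u))))

-- Placements all of whose cuts are crossed by at most two edges.

module ClampLayout (m : ℕ) (11≤m : 11 ≤ m) where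
  open Clamp m 11≤m
  open Graph clamp using (_~_)

  -- Twice the midpoint of the edge, hence independent of its direction. Distinct keys imply
  -- distinct edges, and keys are easily compared by their column component.
  key : Position → Position → ℕ × ℕ
  key (i , j) (i′ , j′) = toℕ i + toℕ i′ , toℕ j + toℕ j′

  Crossing : (Position → Bool) → ℕ × ℕ → Set
  Crossing S k = ∃₂ λ u v → u ~ v × S u ≢ S v × key u v ≡ k

  -- No three edges cross; edges are told apart by their keys.
  Narrow : (Position → Bool) → Set
  Narrow S = ∀ {k₁ k₂ k₃} → k₁ ≢ k₂ → k₁ ≢ k₃ → k₂ ≢ k₃ →
    Crossing S k₁ → Crossing S k₂ → ¬ Crossing S k₃

  <⇒key≢ : ∀ {k k′ : ℕ × ℕ} → proj₂ k < proj₂ k′ → k ≢ k′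
  <⇒key≢ lt eq = ℕ.<⇒≢ lt (cong proj₂ eq)

  j₁ : Fin columns
  j₁ = fromℕ< 1<columns

  j₁≡1 : toℕ j₁ ≡ 1
  j₁≡1 = Fin.toℕ-fromℕ< 1<columns

  -- The column m - 1 of `b` and `b′`.
  L : ℕ
  L = toℕ (opposite j₁)

  1+L≡m : suc L ≡ m
  1+L≡m = subst (λ k → k + L ≡ m) j₁≡1 (column+opposite j₁)

  10≤L : 10 ≤ L
  10≤L = ℕ.s≤s⁻¹ (subst (11 ≤_) (sym 1+L≡m) 11≤m)

  a a′ b b′ x x′ : Position
  a  = 0F , j₁
  a′ = 1F , j₁
  b  = 0F , opposite j₁
  b′ = 1F , opposite j₁
  x  = 0F , 0F
  x′ = 1F , 0F

  a′~b′ : a′ ~ b′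
  a′~b′ = inj₂ (inj₁ ((refl , j₁≡1) ,
    (refl , trans (cong toℕ (Fin.opposite-involutive j₁)) j₁≡1)))

  module _ {S : Position → Bool} where

    cross-xa : S x ≢ S a → Crossing S (0 , 1)
    cross-xa sep = x , a , inj₁ (inj₂ (refl , j₁≡1) , inj₁ refl , inj₁ refl) , sep , cong (0 ,_) j₁≡1

    cross-xx′ : S x ≢ S x′ → Crossing S (1 , 0)
    cross-xx′ sep = x , x′ , inj₁ (inj₁ (refl , refl) , inj₁ refl , inj₂ (inj₁ z≤n)) , sep , refl

    cross-x′a′ : S x′ ≢ S a′ → Crossing S (2 , 1)
    cross-x′a′ sep = x′ , a′ ,
      inj₁ (inj₂ (refl , j₁≡1) , inj₂ (inj₁ z≤n) , inj₂ (inj₁ (ℕ.≤-reflexive j₁≡1))) ,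
      sep , cong (2 ,_) j₁≡1

    cross-aa′ : S a ≢ S a′ → Crossing S (1 , 2)
    cross-aa′ sep = a , a′ ,
      inj₁ (inj₁ (refl , refl) , inj₁ refl , inj₂ (inj₁ (ℕ.≤-reflexive j₁≡1))) ,
      sep , cong (1 ,_) (cong₂ _+_ j₁≡1 j₁≡1)

    cross-bb′ : S b ≢ S b′ → Crossing S (1 , L + L)
    cross-bb′ sep = b , b′ ,
      inj₁ (inj₁ (refl , refl) , inj₁ refl ,
        inj₂ (inj₂ (ℕ.≤-reflexive (trans (cong toℕ (Fin.opposite-involutive j₁)) j₁≡1)))) ,
      sep , refl

    cross-a′b′ : S a′ ≢ S b′ → Crossing S (2 , 1 + L)
    cross-a′b′ sep = a′ , b′ , a′~b′ , sep , cong (λ k → 2 , k + L) j₁≡1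

    -- Induction backwards along the top row: either the last edge crosses, or its left end is on
    -- the same side as its right end and can replace it. The bounds on `i` let crossings from
    -- different stretches be told apart by key.
    cross-top : ∀ h {j j′} → toℕ j ≤ h → toℕ j′ ≡ h → S (0F , j) ≢ S (0F , j′) →
      ∃ λ i → toℕ j ≤ i × i < h × Crossing S (0 , i + suc i)
    cross-top h j≤h j′≡h sep with ℕ.m≤n⇒m<n∨m≡n j≤h
    cross-top h j≤h j′≡h sep | inj₂ j≡h =
      ⊥-elim (sep (cong (λ j → S (0F , j)) (Fin.toℕ-injective (trans j≡h (sym j′≡h)))))
    cross-top (suc h) {j} {j′} j≤h j′≡h sep | inj₁ (s≤s j≤) = go (S (0F , prev) Bool.≟ S (0F , j′))
      where
      bound : h < columns
      bound = ℕ.<-trans (subst (h <_) (sym j′≡h) (ℕ.n<1+n h)) (Fin.toℕ<n j′)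

      prev : Fin columns
      prev = fromℕ< bound

      prev≡h : toℕ prev ≡ h
      prev≡h = Fin.toℕ-fromℕ< bound

      go : Dec (S (0F , prev) ≡ S (0F , j′)) →
           ∃ λ i → toℕ j ≤ i × i < suc h × Crossing S (0 , i + suc i)
      go (no ≢′) = h , j≤ , ℕ.n<1+n h , _ , _ ,
        inj₁ (inj₂ (refl , trans (cong₂ ∣_-_∣ prev≡h j′≡h) (∣n-1+n∣≡1 h)) , inj₁ refl , inj₁ refl) ,
        ≢′ , cong (0 ,_) (cong₂ _+_ prev≡h j′≡h)
      go (yes eq) with cross-top h {j} {prev} j≤ prev≡h (λ eq′ → sep (trans eq′ eq))
      ... | i , j≤i , i<h , c = i , j≤i , ℕ.m<n⇒m<1+n i<h , c

    3≤i+1+i : ∀ {i} → 1 ≤ i → 3 ≤ i + suc i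
    3≤i+1+i 1≤i = ℕ.+-mono-≤ 1≤i (s≤s 1≤i)

    -- The path `a`, `x`, `x′`, `a′`. Its edges have column key at most 1, the edge `aa′` has 2, and
    -- those in `cross-right` have at least 3.
    cross-left : S a ≢ S a′ → ∃ λ k → proj₂ k ≤ 1 × Crossing S k
    cross-left sep with ≢-split sep (S x)
    ... | inj₁ a≢x = _ , ℕ.≤-refl , cross-xa (a≢x ∘ sym)
    ... | inj₂ x≢a′ with ≢-split x≢a′ (S x′)
    ...   | inj₁ x≢x′  = _ , z≤n , cross-xx′ x≢x′
    ...   | inj₂ x′≢a′ = _ , ℕ.≤-refl , cross-x′a′ x′≢a′

    -- The path from `a` along the top row to `b`, down to `b′` and back by the long edge.
    cross-right : S a ≢ S a′ → ∃ λ k → 3 ≤ proj₂ k × Crossing S k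
    cross-right sep with ≢-split sep (S b)
    ... | inj₁ a≢b =
      let i , j₁≤i , _ , c = cross-top L {j₁} {opposite j₁}
            (subst (_≤ L) (sym j₁≡1) (ℕ.≤-trans (s≤s z≤n) 10≤L)) refl a≢b
      in _ , 3≤i+1+i (subst (_≤ i) j₁≡1 j₁≤i) , c
    ... | inj₂ b≢a′ with ≢-split b≢a′ (S b′)
    ...   | inj₁ b≢b′  = _ , ℕ.≤-trans (ℕ.≤-trans (s≤s (s≤s (s≤s z≤n))) 10≤L) (ℕ.m≤m+n L L) , cross-bb′ b≢b′
    ...   | inj₂ b′≢a′ = _ , s≤s (ℕ.≤-trans (s≤s (s≤s z≤n)) 10≤L) , cross-a′b′ (b′≢a′ ∘ sym)

    -- a and a′ are joined by three edge-disjoint paths.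
    narrow⇒a≡a′ : Narrow S → S a ≡ S a′
    narrow⇒a≡a′ narrow with S a Bool.≟ S a′
    ... | yes eq = eq
    ... | no  sep =
      let _ , k≤1 , left = cross-left sep
          _ , 3≤k , right = cross-right sep
      in ⊥-elim (narrow (<⇒key≢ (s≤s k≤1)) (<⇒key≢ (ℕ.≤-<-trans k≤1 (ℕ.≤-trans (s≤s (s≤s z≤n)) 3≤k)))
           (<⇒key≢ 3≤k) left (cross-aa′ sep) right)

    -- The top row from `a` to the node in column `j`, and from there to `b`, each contains a
    -- crossing edge. Their keys differ and both exceed those of `xa` and `x′a′`, so either of the
    -- latter would be a third crossing.
    narrow⇒x-with-a : Narrow S → ∀ {j} → 1 ≤ toℕ j → toℕ j ≤ L →
      S (0F , j) ≢ S a → S (0F , j) ≢ S b → S x ≡ S a × S x′ ≡ S a′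
    narrow⇒x-with-a narrow {j} 1≤j j≤L c≢a c≢b
      with i  , j₁≤i , i<j , cross  ← cross-top (toℕ j) {j₁} {j} (subst (_≤ toℕ j) (sym j₁≡1) 1≤j) refl (c≢a ∘ sym)
         | i′ , j≤i′ , _  , cross′ ← cross-top L {j} {opposite j₁} j≤L refl c≢b
      = decidable-stable (_ Bool.≟ _) (λ sep → third ℕ.≤-refl (cross-xa sep))
      , decidable-stable (_ Bool.≟ _) (λ sep → third ℕ.≤-refl (cross-x′a′ sep))
      where
      i<i′ : i < i′
      i<i′ = ℕ.<-≤-trans i<j j≤i′

      3≤ : 3 ≤ i + suc i
      3≤ = 3≤i+1+i (subst (_≤ i) j₁≡1 j₁≤i)

      keys< : i + suc i < i′ + suc i′
      keys< = ℕ.+-mono-< i<i′ (s≤s i<i′)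

      third : ∀ {k} → proj₂ k ≤ 1 → ¬ Crossing S k
      third k≤1 c = narrow (<⇒key≢ k<) (<⇒key≢ (ℕ.<-trans k< keys<)) (<⇒key≢ keys<) c cross cross′
        where k< = ℕ.≤-<-trans k≤1 (ℕ.≤-trans (s≤s (s≤s z≤n)) 3≤)

    narrow⇒not-all-three : Narrow S → S x ≢ S a → S x′ ≢ S a′ → ¬ (S a′ ≢ S b′)
    narrow⇒not-all-three narrow x≢a x′≢a′ a′≢b′ = narrow (λ ()) (λ ())
      (<⇒key≢ (s≤s (ℕ.≤-trans (s≤s z≤n) 10≤L)))
      (cross-xa x≢a) (cross-x′a′ x′≢a′) (cross-a′b′ a′≢b′)

  -- All that is retained of an embedding into a strip of width 2, with `f` the host column. The
  -- form for arbitrary `f` makes it applicable to the reflected placement too.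
  record Layout (f : Position → ℕ) : Set where
    field
      row       : Position → Fin 2
      injective : ∀ {u v} → f u ≡ f v → row u ≡ row v → u ≡ v
      narrow    : ∀ t → Narrow (below f t)

    bag : ∀ {u v w} → f u ≡ f v → f u ≡ f w → u ≡ v ⊎ u ≡ w ⊎ v ≡ w
    bag {u} {v} {w} u≡v u≡w =
      Sum.map (injective u≡v) (Sum.map (injective u≡w) (injective (trans (sym u≡v) u≡w)))
        (Fin2-pigeonhole (row u) (row v) (row w))

    a≡a′ : f a ≡ f a′
    a≡a′ = below-equal⇒≡ f λ t → narrow⇒a≡a′ (narrow t)

    -- A column holds at most two nodes, and `a`, `a′` fill theirs.
    only-a-a′ : ∀ {v} → a ≢ v → a′ ≢ v → f a ≢ f v
    only-a-a′ a≢v a′≢v eq with bag a≡a′ eq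
    ... | inj₂ (inj₁ a≡v)  = a≢v a≡v
    ... | inj₂ (inj₂ a′≡v) = a′≢v a′≡v

    not-column-0 : ∀ {i i′ : Fin 2} → (i , j₁) ≢ (i′ , 0F)
    not-column-0 eq with () ← trans (sym j₁≡1) (cong (toℕ ∘ proj₂) eq)

    fa≢fx : f a ≢ f x
    fa≢fx = only-a-a′ not-column-0 not-column-0

    fa≢fx′ : f a ≢ f x′
    fa≢fx′ = only-a-a′ not-column-0 not-column-0

    fa≢fb : f a ≢ f b
    fa≢fb = only-a-a′ (λ eq → ℕ.<⇒≢ 1<L (trans (sym j₁≡1) (cong (toℕ ∘ proj₂) eq))) (λ ())
      where
      1<L : 1 < L
      1<L = ℕ.≤-trans (s≤s (s≤s z≤n)) 10≤L

  module _ {f : Position → ℕ} (layout : Layout f) (b≡b′ : f b ≡ f b′)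
           {j : Fin columns} (1≤j : 1 ≤ toℕ j) (j≤L : toℕ j ≤ L) where
    open Layout layout

    -- The parameter `b≡b′` will come from `a≡a′` of the reflected layout. It places `b′` beyond the
    -- cut after `a`, so that `a′b′` crosses this cut.
    a-first : f a < f b → f a ≤ f (0F , j)
    a-first fa<fb = ℕ.≮⇒≥ λ fc<fa →
      let x≡a , x′≡a′ = narrow⇒x-with-a (narrow (f a)) 1≤j j≤L
            (below-separates f fc<fa ℕ.≤-refl) (below-separates f fc<fa (ℕ.<⇒≤ fa<fb))
          fa≤fx  = below-false⁻¹ f {v = x} (trans x≡a (below-false f {v = a} ℕ.≤-refl))
          fa≤fx′ = below-false⁻¹ f {v = x′} (trans x′≡a′ (below-false f {v = a′} (ℕ.≤-reflexive a≡a′)))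
      -- The threshold moves from `f a` to `suc (f a)`, past the full column of `a`; now `x` and
      -- `x′` are on the other side from `a` and `a′`.
      in narrow⇒not-all-three (narrow (suc (f a)))
           (below-separates f {u = a} (ℕ.n<1+n (f a)) (ℕ.≤∧≢⇒< fa≤fx fa≢fx) ∘ sym)
           (below-separates f {u = a′} (s≤s (ℕ.≤-reflexive (sym a≡a′))) (ℕ.≤∧≢⇒< fa≤fx′ fa≢fx′) ∘ sym)
           (below-separates f {u = a′} (s≤s (ℕ.≤-reflexive (sym a≡a′))) (subst (f a <_) b≡b′ fa<fb))

    -- The order of the columns is reversed. As `below` is strict, the thresholds `f a` and
    -- `suc (f a)` exchange their roles.
    a-last : f b < f a → f (0F , j) ≤ f a
    a-last fb<fa = ℕ.≮⇒≥ λ fa<fc →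
      let x≡a , x′≡a′ = narrow⇒x-with-a (narrow (suc (f a))) 1≤j j≤L
            (below-separates f {u = a} (ℕ.n<1+n (f a)) fa<fc ∘ sym)
            (below-separates f {u = b} (ℕ.m<n⇒m<1+n fb<fa) fa<fc ∘ sym)
          fx≤fa  = ℕ.s≤s⁻¹ (below-true⁻¹ f {v = x} (trans x≡a (below-true f {v = a} (ℕ.n<1+n (f a)))))
          fx′≤fa = ℕ.s≤s⁻¹ (below-true⁻¹ f {v = x′} (trans x′≡a′
                     (below-true f {v = a′} (s≤s (ℕ.≤-reflexive (sym a≡a′))))))
      in narrow⇒not-all-three (narrow (f a))
           (below-separates f {v = a} (ℕ.≤∧≢⇒< fx≤fa (fa≢fx ∘ sym)) ℕ.≤-refl)
           (below-separates f {v = a′} (ℕ.≤∧≢⇒< fx′≤fa (fa≢fx′ ∘ sym)) (ℕ.≤-reflexive a≡a′))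
           (below-separates f {v = a′} (subst (_< f a) b≡b′ fb<fa) (ℕ.≤-reflexive a≡a′) ∘ sym)

  -- The left-right reflection of the graph.

  reflect : Position → Position
  reflect (i , j) = i , opposite j

  reflect-injective : ∀ {u v} → reflect u ≡ reflect v → u ≡ v
  reflect-injective {_ , j} {_ , j′} eq = cong₂ _,_ (cong proj₁ eq) (begin
    j                       ≡⟨ Fin.opposite-involutive j ⟨
    opposite (opposite j)   ≡⟨ cong (opposite ∘ proj₂) eq ⟩
    opposite (opposite j′)  ≡⟨ Fin.opposite-involutive j′ ⟩
    j′                      ∎)
    where open ≡-Reasoning

  reflect-Kept : ∀ {u} → Kept u → Kept (reflect u)
  reflect-Kept         (inj₁ top)          = inj₁ top
  reflect-Kept {_ , j} (inj₂ (inj₁ left))  =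
    inj₂ (inj₂ (subst (_≤ 1) (cong toℕ (sym (Fin.opposite-involutive j))) left))
  reflect-Kept         (inj₂ (inj₂ right)) = inj₂ (inj₁ right)

  reflect-Long : ∀ {u v} → Long u v → Long (reflect v) (reflect u)
  reflect-Long {_ , j} ((i≡ , j≡) , (i′≡ , j′≡)) =
    (i′≡ , j′≡) , (i≡ , trans (cong toℕ (Fin.opposite-involutive j)) j≡)

  -- Translating by `toℕ j` makes one argument equal to m, which can be rewritten through `j′`; the
  -- common summand `o′` then cancels.
  opposite-distance : ∀ (j j′ : Fin columns) →
    ∣ toℕ (opposite j) - toℕ (opposite j′) ∣ ≡ ∣ toℕ j - toℕ j′ ∣
  opposite-distance j j′ = begin
    ∣ o - o′ ∣                ≡⟨ ℕ.∣-∣-comm o o′ ⟩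
    ∣ o′ - o ∣                ≡⟨ ℕ.∣m+n-m+o∣≡∣n-o∣ (toℕ j) o′ o ⟨
    ∣ toℕ j + o′ - toℕ j + o ∣  ≡⟨ cong (∣ toℕ j + o′ -_∣) (trans (column+opposite j) (sym (column+opposite j′))) ⟩
    ∣ toℕ j + o′ - toℕ j′ + o′ ∣ ≡⟨ cong₂ ∣_-_∣ (ℕ.+-comm (toℕ j) o′) (ℕ.+-comm (toℕ j′) o′) ⟩
    ∣ o′ + toℕ j - o′ + toℕ j′ ∣ ≡⟨ ℕ.∣m+n-m+o∣≡∣n-o∣ o′ (toℕ j) (toℕ j′) ⟩
    ∣ toℕ j - toℕ j′ ∣        ∎
    where
    open ≡-Reasoning
    o  = toℕ (opposite j)
    o′ = toℕ (opposite j′)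

  reflect-~ : ∀ {u v} → u ~ v → reflect u ~ reflect v
  reflect-~ {u} {v} (inj₁ (inj₁ (d , refl) , k , k′)) =
    inj₁ (inj₁ (d , refl) , reflect-Kept {u} k , reflect-Kept {v} k′)
  reflect-~ {u} {v} (inj₁ (inj₂ (refl , d) , k , k′)) =
    inj₁ (inj₂ (refl , trans (opposite-distance (proj₂ u) (proj₂ v)) d) , reflect-Kept {u} k , reflect-Kept {v} k′)
  reflect-~ {u} {v} (inj₂ (inj₁ l)) = inj₂ (inj₂ (reflect-Long {u} {v} l))
  reflect-~ {u} {v} (inj₂ (inj₂ l)) = inj₂ (inj₁ (reflect-Long {v} {u} l))

  -- Reflection keeps the row component of a key and complements the column component to 2m, so
  -- distinct keys remain distinct.
  reflect-Crossing : ∀ {S k} → Crossing (S ∘ reflect) k →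
    ∃ λ k′ → proj₁ k ≡ proj₁ k′ × proj₂ k + proj₂ k′ ≡ m + m × Crossing S k′
  reflect-Crossing (u@(i , j) , v@(i′ , j′) , u~v , sep , refl) =
    _ , refl , sums , reflect u , reflect v , reflect-~ {u} {v} u~v , sep , refl
    where
    open CommutativeSemigroupProperties ℕ.+-commutativeSemigroup using (interchange)

    sums : (toℕ j + toℕ j′) + (toℕ (opposite j) + toℕ (opposite j′)) ≡ m + m
    sums = trans (interchange (toℕ j) (toℕ j′) (toℕ (opposite j)) (toℕ (opposite j′)))
                 (cong₂ _+_ (column+opposite j) (column+opposite j′))

  reflect-Narrow : ∀ {S} → Narrow S → Narrow (S ∘ reflect)
  reflect-Narrow narrow k₁≢k₂ k₁≢k₃ k₂≢k₃ c₁ c₂ c₃ =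
    let _ , r₁ , s₁ , d₁ = reflect-Crossing c₁
        _ , r₂ , s₂ , d₂ = reflect-Crossing c₂
        _ , r₃ , s₃ , d₃ = reflect-Crossing c₃
    in narrow (k₁≢k₂ ∘ unreflect r₁ s₁ r₂ s₂) (k₁≢k₃ ∘ unreflect r₁ s₁ r₃ s₃)
              (k₂≢k₃ ∘ unreflect r₂ s₂ r₃ s₃) d₁ d₂ d₃
    where
    unreflect : ∀ {k k′ l l′ : ℕ × ℕ} →
      proj₁ k ≡ proj₁ k′ → proj₂ k + proj₂ k′ ≡ m + m →
      proj₁ l ≡ proj₁ l′ → proj₂ l + proj₂ l′ ≡ m + m → k′ ≡ l′ → k ≡ l
    unreflect {k} {k′} {l} refl s refl s′ refl =
      cong (proj₁ k ,_) (ℕ.+-cancelʳ-≡ (proj₂ k′) (proj₂ k) (proj₂ l) (trans s (sym s′)))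

  reflect-Layout : ∀ {f} → Layout f → Layout (f ∘ reflect)
  reflect-Layout layout = record
    { row       = row ∘ reflect
    ; injective = λ f≡ r≡ → reflect-injective (injective f≡ r≡)
    ; narrow    = λ t → reflect-Narrow (narrow t)
    }
    where open Layout layout

  -- Counting nodes to stretch the long edge.

  between⇒≤ : ∀ {f} → Layout f → ∀ lo d →
    (∀ j → 1 ≤ toℕ j → toℕ j ≤ L → lo ≤ f (0F , j) × f (0F , j) ≤ lo + d) → L ≤ suc d * 2
  -- The `L` top nodes in columns 1 to `L` are sent to pairs of a host column, counted from `lo`,
  -- and a host row. This is injective, and there are `suc d * 2` pairs.
  between⇒≤ {f} layout lo d bounds = Fin.injective⇒≤ {f = λ k → combine (offset k) (row (0F , column k))}
    λ {k} {l} eq → column-injective (cong proj₂ (injective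
      (offset-injective (Fin.combine-injectiveˡ (offset k) _ (offset l) _ eq))
      (Fin.combine-injectiveʳ (offset k) _ (offset l) _ eq)))
    where
    open Layout layout

    column< : (k : Fin L) → suc (toℕ k) < columns
    column< k = s≤s (subst (suc (toℕ k) ≤_) 1+L≡m (ℕ.m<n⇒m<1+n (Fin.toℕ<n k)))

    column : Fin L → Fin columns
    column k = fromℕ< (column< k)

    toℕ-column : ∀ k → toℕ (column k) ≡ suc (toℕ k)
    toℕ-column k = Fin.toℕ-fromℕ< (column< k)

    column-injective : ∀ {k l} → column k ≡ column l → k ≡ l
    column-injective {k} {l} eq = Fin.toℕ-injective (ℕ.suc-injective
      (trans (sym (toℕ-column k)) (trans (cong toℕ eq) (toℕ-column l))))

    bound : ∀ k → lo ≤ f (0F , column k) × f (0F , column k) ≤ lo + d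
    bound k = bounds (column k) (subst (1 ≤_) (sym (toℕ-column k)) (s≤s z≤n))
      (subst (_≤ L) (sym (toℕ-column k)) (Fin.toℕ<n k))

    offset< : ∀ k → f (0F , column k) ∸ lo < suc d
    offset< k = s≤s (ℕ.m≤n+o⇒m∸n≤o (f (0F , column k)) lo (proj₂ (bound k)))

    offset : Fin L → Fin (suc d)
    offset k = fromℕ< (offset< k)

    offset-injective : ∀ {k l} → offset k ≡ offset l → f (0F , column k) ≡ f (0F , column l)
    offset-injective {k} {l} eq = ℕ.∸-cancelʳ-≡ (proj₁ (bound k)) (proj₁ (bound l))
      (Fin.fromℕ<-injective _ _ (offset< k) (offset< l) eq)

  -- The layout bounds the top nodes on the side of `a`; its reflection, in which `b` takes the
  -- place of `a`, bounds them on the side of `b`. The columns of `a′` and `b′` are those of `a` and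
  -- `b`.
  long-edge-stretched : ∀ {f} → Layout f → L ≤ suc ∣ f a′ - f b′ ∣ * 2
  long-edge-stretched {f} layout = subst (λ d → L ≤ suc d * 2) (cong₂ ∣_-_∣ a≡a′ b≡b′) stretched
    where
    open Layout layout

    mirrored : Layout (f ∘ reflect)
    mirrored = reflect-Layout layout

    b≡b′ : f b ≡ f b′
    b≡b′ = Layout.a≡a′ mirrored

    -- `opposite` is an involution only propositionally, so facts about the reflected layout must be
    -- transported back.
    back : ∀ i j → f (i , opposite (opposite j)) ≡ f (i , j)
    back i j = cong (λ j → f (i , j)) (Fin.opposite-involutive j)

    a≡a′-mirrored : f (reflect b) ≡ f (reflect b′)
    a≡a′-mirrored = trans (back 0F j₁) (trans a≡a′ (sym (back 1F j₁)))

    1≤opposite : ∀ {j} → toℕ j ≤ L → 1 ≤ toℕ (opposite j)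
    1≤opposite {j} j≤L = ℕ.+-cancelˡ-≤ (toℕ j) _ _ (begin
      toℕ j + 1                 ≡⟨ ℕ.+-comm (toℕ j) 1 ⟩
      suc (toℕ j)               ≤⟨ s≤s j≤L ⟩
      suc L                     ≡⟨ 1+L≡m ⟩
      m                         ≡⟨ column+opposite j ⟨
      toℕ j + toℕ (opposite j)  ∎)
      where open ℕ.≤-Reasoning

    opposite≤L : ∀ {j} → 1 ≤ toℕ j → toℕ (opposite j) ≤ L
    opposite≤L {j} 1≤j = ℕ.s≤s⁻¹ (begin
      1 + toℕ (opposite j)      ≤⟨ ℕ.+-monoˡ-≤ (toℕ (opposite j)) 1≤j ⟩
      toℕ j + toℕ (opposite j)  ≡⟨ column+opposite j ⟩
      m                         ≡⟨ 1+L≡m ⟨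
      suc L                     ∎)
      where open ℕ.≤-Reasoning

    module _ {j : Fin columns} (1≤j : 1 ≤ toℕ j) (j≤L : toℕ j ≤ L) where

      b-first : f b < f a → f b ≤ f (0F , j)
      b-first lt = subst (f b ≤_) (back 0F j)
        (a-first mirrored a≡a′-mirrored (1≤opposite j≤L) (opposite≤L 1≤j)
          (subst (f b <_) (sym (back 0F j₁)) lt))

      b-last : f a < f b → f (0F , j) ≤ f b
      b-last lt = subst (_≤ f b) (back 0F j)
        (a-last mirrored a≡a′-mirrored (1≤opposite j≤L) (opposite≤L 1≤j)
          (subst (_< f b) (sym (back 0F j₁)) lt))

    stretched : L ≤ suc ∣ f a - f b ∣ * 2
    stretched with ℕ.<-cmp (f a) (f b)
    ... | tri≈ _ eq _ = ⊥-elim (fa≢fb eq)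
    ... | tri< lt _ _ = between⇒≤ layout (f a) ∣ f a - f b ∣ λ j 1≤j j≤L →
      a-first layout b≡b′ 1≤j j≤L lt ,
      ℕ.≤-trans (b-last 1≤j j≤L lt) (ℕ.m≤n+∣n-m∣ (f b) (f a))
    ... | tri> _ _ gt = between⇒≤ layout (f b) ∣ f a - f b ∣ λ j 1≤j j≤L →
      b-first 1≤j j≤L gt ,
      ℕ.≤-trans (a-last layout b≡b′ 1≤j j≤L gt) (ℕ.m≤n+∣m-n∣ (f a) (f b))

-- Grids with a side of length at most 2.

record Strip {N : ℕ} (H : Graph N) : Set where
  open Graph H
  field
    row       : Node → Fin 2
    col       : Node → ℕ
    injective : ∀ {u v} → col u ≡ col v → row u ≡ row v → u ≡ v
    -- The second case is a step within a column; such a step crosses no cut.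
    adjacent  : ∀ {u v} → u ~ v → (row u ≡ row v × ∣ col u - col v ∣ ≡ 1) ⊎ col u ≡ col v

gridStrip : ∀ ℓ₁ ℓ₂ .{{_ : NonZero ℓ₁}} .{{_ : NonZero ℓ₂}} → ℓ₁ ≤ 2 → Strip (grid ℓ₁ ℓ₂)
gridStrip ℓ₁ ℓ₂ ℓ₁≤2 = record
  { row       = λ (i , j) → inject≤ i ℓ₁≤2
  ; col       = λ (i , j) → toℕ j
  ; injective = λ j≡ i≡ → cong₂ _,_ (Fin.inject≤-injective _ _ _ _ i≡) (Fin.toℕ-injective j≡)
  ; adjacent  = λ where
      (inj₁ (_ , j≡))  → inj₂ (cong toℕ j≡)
      (inj₂ (refl , d)) → inj₁ (refl , d)
  }

gridStripᵀ : ∀ ℓ₁ ℓ₂ .{{_ : NonZero ℓ₁}} .{{_ : NonZero ℓ₂}} → ℓ₂ ≤ 2 → Strip (grid ℓ₁ ℓ₂)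
gridStripᵀ ℓ₁ ℓ₂ ℓ₂≤2 = record
  { row       = λ (i , j) → inject≤ j ℓ₂≤2
  ; col       = λ (i , j) → toℕ i
  ; injective = λ i≡ j≡ → cong₂ _,_ (Fin.toℕ-injective i≡) (Fin.inject≤-injective _ _ _ _ j≡)
  ; adjacent  = λ where
      (inj₁ (d , refl)) → inj₁ (refl , d)
      (inj₂ (i≡ , _))   → inj₂ (cong toℕ i≡)
  }

module StripProperties {N : ℕ} {H : Graph N} (strip : Strip H) where
  open Graph H
  open Strip strip

  private
    ∣-∣≡1⇒suc : ∀ {a b} → ∣ a - b ∣ ≡ 1 → a < b → suc a ≡ b
    ∣-∣≡1⇒suc {a} {b} eq a<b = begin
      suc a          ≡⟨ ℕ.+-comm 1 a ⟩
      a + 1          ≡⟨ cong (a ℕ.+_) (trans (sym eq) (ℕ.m≤n⇒∣m-n∣≡n∸m (ℕ.<⇒≤ a<b))) ⟩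
      a + (b ∸ a)    ≡⟨ ℕ.m+[n∸m]≡n (ℕ.<⇒≤ a<b) ⟩
      b              ∎
      where open ≡-Reasoning

  step-distance : ∀ {u v} → u ~ v → ∣ col u - col v ∣ ≤ 1
  step-distance u~v with adjacent u~v
  ... | inj₁ (_ , d) = ℕ.≤-reflexive d
  ... | inj₂ eq      = subst (_≤ 1) (sym (ℕ.m≡n⇒∣m-n∣≡0 eq)) z≤n

  distance≤length : ∀ {u v} (w : Star _~_ u v) → ∣ col u - col v ∣ ≤ length (steps w)
  distance≤length {u} ε = ℕ.≤-reflexive (ℕ.∣n-n∣≡0 (col u))
  distance≤length {u} {v} (_◅_ {j = y} s w) = ℕ.≤-trans (ℕ.∣-∣-triangle (col u) (col y) (col v))
    (ℕ.+-mono-≤ (step-distance s) (distance≤length w))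

  CutEdge : ℕ → Node → Node → Set
  CutEdge t y z = y ~ z × row y ≡ row z × suc (col y) ≡ t × col z ≡ t

  cutEdge : ∀ {t y z} → y ~ z → col y < t → t ≤ col z → CutEdge t y z
  cutEdge {t} {y} {z} y~z y<t t≤z with adjacent y~z
  ... | inj₂ eq      = contradiction eq (ℕ.<⇒≢ (ℕ.<-≤-trans y<t t≤z))
  ... | inj₁ (r , d) = y~z , r , ℕ.≤-antisym y<t (subst (t ≤_) (sym next) t≤z)
                     , ℕ.≤-antisym (subst (_≤ t) next y<t) t≤z
    where
    next : suc (col y) ≡ col z
    next = ∣-∣≡1⇒suc d (ℕ.<-≤-trans y<t t≤z)

  -- A cut edge stays in its row and its columns are fixed by `t`. Hence each row contributes at
  -- most one edge to a cut.
  cutEdge-unique : ∀ {t y z y′ z′} → CutEdge t y z → CutEdge t y′ z′ → row y ≡ row y′ →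
    (y , z) ≡ (y′ , z′)
  cutEdge-unique (_ , r , y≡ , z≡) (_ , r′ , y′≡ , z′≡) eq = cong₂ _,_
    (injective (ℕ.suc-injective (trans y≡ (sym y′≡))) eq)
    (injective (trans z≡ (sym z′≡)) (trans (sym r) (trans eq r′)))

  -- A discrete intermediate value argument: the first step that changes sides is the cut edge. The
  -- cut edge is always directed rightwards, whichever way the walk traverses it.
  walk-crosses : ∀ {t u v} (w : Star _~_ u v) → (col u < t × t ≤ col v) ⊎ (col v < t × t ≤ col u) →
    ∃₂ λ y z → CutEdge t y z × ((y , z) ∈ steps w ⊎ (z , y) ∈ steps w)
  walk-crosses ε (inj₁ (lt , le)) = contradiction le (ℕ.<⇒≱ lt)
  walk-crosses ε (inj₂ (lt , le)) = contradiction le (ℕ.<⇒≱ lt)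
  walk-crosses {t} (_◅_ {u} {y} s w) sides with sides | col y ℕ.<? t
  ... | inj₁ (u< , _)  | no  y≮t = u , y , cutEdge s u< (ℕ.≮⇒≥ y≮t) , inj₁ (here refl)
  ... | inj₂ (_ , t≤u) | yes y<t = y , u , cutEdge (~-sym s) y<t t≤u , inj₂ (here refl)
  ... | inj₁ (_ , t≤v) | yes y<t =
    let p , q , cut , ∈w = walk-crosses w (inj₁ (y<t , t≤v)) in p , q , cut , Sum.map there there ∈w
  ... | inj₂ (v< , _)  | no  y≮t =
    let p , q , cut , ∈w = walk-crosses w (inj₂ (v< , ℕ.≮⇒≥ y≮t)) in p , q , cut , Sum.map there there ∈w

-- From an embedding with congestion 1 to a layout.

module _ (m : ℕ) (11≤m : 11 ≤ m) {N : ℕ} {H : Graph N} (strip : Strip H)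
         (E : Embedding (Clamp.clamp m 11≤m) H) (congestion≡1 : edgeCongestion E ≡ 1) where
  open Clamp m 11≤m
  open ClampLayout m 11≤m
  open Strip strip
  open StripProperties strip
  private
    module C where
      open Graph clamp public
      open GraphProperties clamp public
    module H where
      open Graph H public
      open GraphProperties H public
    open EmbeddingProperties E

  column : Position → ℕ
  column u = col (φ E u)

  private
    Traversed : List (H.Node × H.Node) → H.Node × H.Node → Set
    Traversed ss d = d ∈ ss ⊎ swap d ∈ ss

    CrossedBy : ℕ → Fin 2 → C.Edge → Set
    CrossedBy t r e = ∃₂ λ y z → CutEdge t y z × row y ≡ r ×
      Traversed (H.steps (proj₁ (ρ E e))) (y , z)

    -- Both routes use the one host edge of row `r` across the cut, and congestion 1 allows it a
    -- single user.
    crossedBy-unique : ∀ {t r e₁ e₂} → CrossedBy t r e₁ → CrossedBy t r e₂ → e₁ ≡ e₂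
    crossedBy-unique (y , z , cut , r≡ , s) (y′ , z′ , cut′ , r′≡ , s′)
      with refl ← cutEdge-unique cut cut′ (trans r≡ (sym r′≡))
      with H.edge-between (proj₁ cut)
    ... | e′ , inj₁ eq = congestion≤1⇒≡ congestion≡1 e′
      (subst (Traversed _) (sym eq) s) (subst (Traversed _) (sym eq) s′)
    ... | e′ , inj₂ eq = congestion≤1⇒≡ congestion≡1 e′
      (subst (Traversed _) (sym eq) (Sum.swap s)) (subst (Traversed _) (sym eq) (Sum.swap s′))

    key-sym : ∀ u v → key u v ≡ key v u
    key-sym (i , j) (i′ , j′) = cong₂ _,_ (ℕ.+-comm (toℕ i) (toℕ i′)) (ℕ.+-comm (toℕ j) (toℕ j′))

    crossing-edge : ∀ {t k} → Crossing (below column t) k →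
      ∃₂ λ e r → key (proj₁ (C.ends e)) (proj₂ (C.ends e)) ≡ k × CrossedBy t r e
    crossing-edge {t} {k} (u , v , u~v , sep , refl) = edge (C.edge-between u~v)
      where
      separated : ∀ {d} → d ≡ (u , v) ⊎ d ≡ (v , u) →
        (column (proj₁ d) < t × t ≤ column (proj₂ d)) ⊎ (column (proj₂ d) < t × t ≤ column (proj₁ d))
      separated (inj₁ refl) = below-separates⁻¹ column sep
      separated (inj₂ refl) = below-separates⁻¹ column (sep ∘ sym)

      same-key : ∀ {d} → d ≡ (u , v) ⊎ d ≡ (v , u) → key (proj₁ d) (proj₂ d) ≡ key u v
      same-key (inj₁ refl) = refl
      same-key (inj₂ refl) = key-sym v u

      edge : (∃ λ e → C.Joins e u v) →
        ∃₂ λ e r → key (proj₁ (C.ends e)) (proj₂ (C.ends e)) ≡ key u v × CrossedBy t r e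
      edge (e , joins) =
        let y , z , cut , s = walk-crosses (proj₁ (ρ E e)) (separated joins)
        in e , row y , same-key joins , y , z , cut , refl , s

  -- Of three edges crossing a cut, two do so in the same row by the pigeonhole principle; they are
  -- then the same edge and have the same key.
  columnLayout : Layout column
  columnLayout = record
    { row       = row ∘ φ E
    ; injective = λ c≡ r≡ → φ-injective E (injective c≡ r≡)
    ; narrow    = λ t k₁≢k₂ k₁≢k₃ k₂≢k₃ c₁ c₂ c₃ →
        let _ , r₁ , key₁ , x₁ = crossing-edge {t} c₁
            _ , r₂ , key₂ , x₂ = crossing-edge {t} c₂
            _ , r₃ , key₃ , x₃ = crossing-edge {t} c₃
        in case Fin2-pigeonhole r₁ r₂ r₃ of λ where
             (inj₁ r≡)        → k₁≢k₂ (same key₁ key₂ r≡ x₁ x₂)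
             (inj₂ (inj₁ r≡)) → k₁≢k₃ (same key₁ key₃ r≡ x₁ x₃)
             (inj₂ (inj₂ r≡)) → k₂≢k₃ (same key₂ key₃ r≡ x₂ x₃)
    }
    where
    same : ∀ {t r r′ e e′ k k′} →
      key (proj₁ (C.ends e)) (proj₂ (C.ends e)) ≡ k →
      key (proj₁ (C.ends e′)) (proj₂ (C.ends e′)) ≡ k′ →
      r ≡ r′ → CrossedBy t r e → CrossedBy t r′ e′ → k ≡ k′
    same {e = e} refl refl refl x x′ with refl ← crossedBy-unique x x′ = refl

  stretch≤dilation : ∣ column a′ - column b′ ∣ ≤ dilation E
  stretch≤dilation = via (C.edge-between a′~b′)
    where
    ends-distance : ∀ {d} → d ≡ (a′ , b′) ⊎ d ≡ (b′ , a′) →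
      ∣ column a′ - column b′ ∣ ≡ ∣ column (proj₁ d) - column (proj₂ d) ∣
    ends-distance (inj₁ refl) = refl
    ends-distance (inj₂ refl) = ℕ.∣-∣-comm (column a′) (column b′)

    via : (∃ λ e → C.Joins e a′ b′) → ∣ column a′ - column b′ ∣ ≤ dilation E
    via (e , joins) = begin
      ∣ column a′ - column b′ ∣                                       ≡⟨ ends-distance joins ⟩
      ∣ column (proj₁ (C.ends e)) - column (proj₂ (C.ends e)) ∣       ≤⟨ distance≤length (proj₁ (ρ E e)) ⟩
      H.pathLength (ρ E e)                                            ≤⟨ pathLength≤dilation e ⟩
      dilation E                                                      ∎
      where open ℕ.≤-Reasoning

  columns≤4*dilation : columns ≤ 4 * dilation E
  columns≤4*dilation = begin
    columns                  ≡⟨ cong suc 1+L≡m ⟨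
    2 + L                    ≤⟨ ℕ.+-monoʳ-≤ 2 (long-edge-stretched columnLayout) ⟩
    -- Here `L` ≤ 2(δ + 1). The additive constant 4 is absorbed by a second copy of `δ * 2`, as δ ≥
    -- 2 follows from 10 ≤ `L`.
    4 + δ * 2                ≤⟨ ℕ.+-monoˡ-≤ (δ * 2) (ℕ.*-monoˡ-≤ 2 2≤δ) ⟩
    δ * 2 + δ * 2            ≡⟨ ℕ.*-distribˡ-+ δ 2 2 ⟨
    δ * 4                    ≡⟨ ℕ.*-comm δ 4 ⟩
    4 * δ                    ≤⟨ ℕ.*-monoʳ-≤ 4 stretch≤dilation ⟩
    4 * dilation E           ∎
    where
    open ℕ.≤-Reasoning
    δ = ∣ column a′ - column b′ ∣

    2≤δ : 2 ≤ δ
    2≤δ = ℕ.s<s⁻¹ (ℕ.*-cancelʳ-< 2 2 (suc δ) (ℕ.<-≤-trans (s≤s (s≤s (s≤s (s≤s (s≤s z≤n)))))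
      (ℕ.≤-trans 10≤L (long-edge-stretched columnLayout))))

-- Primes and the factorisations of 2p.

unbounded-primes : ∀ M → ∃ λ p → M < p × Prime p
unbounded-primes M = go (factors F) (isFactorisation F) (factorsPrime F)
  where
  open PrimeFactorisation
  F = factorise (suc (M !))

  go : ∀ ps → suc (M !) ≡ product ps → All Prime ps → ∃ λ p → M < p × Prime p
  -- An empty product would give M! + 1 = 1.
  go []       eq _             = contradiction (ℕ.suc-injective eq) (ℕ.m<n⇒n≢0 (ℕ.1≤n! M))
  go (p ∷ ps) eq (prime-p ∷ _) = p , ℕ.≰⇒> p≰M , prime-p
    where
    p∣p! : ∀ {p} .{{_ : NonZero p}} → p ∣ p !
    p∣p! {suc p} = m∣m*n (p !)

    -- Euclid's argument: a prime factor of M! + 1 that is at most M divides M!, hence 1.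
    p≰M : ¬ (p ≤ M)
    p≰M p≤M = ¬prime[1] (subst Prime (∣1⇒≡1 p∣1) prime-p)
      where
      p∣1 : p ∣ 1
      p∣1 = ∣m+n∣m⇒∣n
        (subst (p ∣_) (trans (sym eq) (ℕ.+-comm 1 (M !))) (m∣m*n (product ps)))
        (∣-trans (p∣p! {{prime⇒nonZero prime-p}}) (m≤n⇒m!∣n! p≤M))

-- The prime p divides one side length, and cancelling it shows that the other divides 2.
2*prime-factor : ∀ {p} → Prime p → ∀ ℓ₁ ℓ₂ → ℓ₁ * ℓ₂ ≡ 2 * p → ℓ₁ ≤ 2 ⊎ ℓ₂ ≤ 2
2*prime-factor {p} prime-p ℓ₁ ℓ₂ eq with euclidsLemma ℓ₁ ℓ₂ prime-p (divides 2 eq)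
... | inj₁ (divides q refl) = inj₂ (∣⇒≤ (divides q (sym (ℕ.*-cancelʳ-≡ (q * ℓ₂) 2 p {{prime⇒nonZero prime-p}} (begin
  q * ℓ₂ * p    ≡⟨ ℕ.*-assoc q ℓ₂ p ⟩
  q * (ℓ₂ * p)  ≡⟨ cong (q *_) (ℕ.*-comm ℓ₂ p) ⟩
  q * (p * ℓ₂)  ≡⟨ ℕ.*-assoc q p ℓ₂ ⟨
  q * p * ℓ₂    ≡⟨ eq ⟩
  2 * p         ∎)))))
  where open ≡-Reasoning
... | inj₂ (divides q refl) = inj₁ (∣⇒≤ (divides q (sym (trans (ℕ.*-comm q ℓ₁) (ℕ.*-cancelʳ-≡ (ℓ₁ * q) 2 p {{prime⇒nonZero prime-p}}
  (trans (ℕ.*-assoc ℓ₁ q p) eq))))))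

-- Linear bounds over the rationals.

/1-mono-≤ : ∀ {d N} → d ≤ N → (+ d / 1) ℚ.≤ (+ N / 1)
-- With a variable numerator the normalised fraction does not compute, so the comparison passes to
-- unnormalised fractions of denominator 1.
/1-mono-≤ {d} {N} d≤N = ℚ.toℚᵘ-cancel-≤ (begin
  ℚ.toℚᵘ (+ d / 1)    ≃⟨ ℚ.toℚᵘ-fromℚᵘ (mkℚᵘ (+ d) 0) ⟩
  mkℚᵘ (+ d) 0        ≤⟨ *≤* (ℤ.*-monoʳ-≤-nonNeg (+ 1) (ℤ.+≤+ d≤N)) ⟩
  mkℚᵘ (+ N) 0        ≃⟨ ℚ.toℚᵘ-fromℚᵘ (mkℚᵘ (+ N) 0) ⟨
  ℚ.toℚᵘ (+ N / 1)    ∎)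
  where open ℚᵘ.≤-Reasoning

⅛*≤ : ∀ {N d} → N ≤ 8 * d → (+ 1 / 8) ℚ.* (+ N / 1) ℚ.≤ (+ d / 1)
⅛*≤ {N} {d} N≤8d = begin
  ⅛ ℚ.* (+ N / 1)          ≤⟨ ℚ.*-monoˡ-≤-nonNeg ⅛ (/1-mono-≤ N≤8d) ⟩
  ⅛ ℚ.* (+ (8 * d) / 1)    ≡⟨ cong (⅛ ℚ.*_) 8*d ⟩
  ⅛ ℚ.* (8ℚ ℚ.* (+ d / 1))  ≡⟨ ℚ.*-assoc ⅛ 8ℚ (+ d / 1) ⟨
  -- The closed product `⅛ ℚ.* 8ℚ` evaluates to `1ℚ`.
  1ℚ ℚ.* (+ d / 1)         ≡⟨ ℚ.*-identityˡ (+ d / 1) ⟩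
  + d / 1                  ∎
  where
  open ℚ.≤-Reasoning
  ⅛ = + 1 / 8
  8ℚ = + 8 / 1

  8*d : + (8 * d) / 1 ≡ 8ℚ ℚ.* (+ d / 1)
  8*d = ℚ.toℚᵘ-injective (ℚᵘ.≃-trans (ℚ.toℚᵘ-fromℚᵘ (mkℚᵘ (+ (8 * d)) 0)) (ℚᵘ.≃-sym
    (ℚᵘ.≃-trans (ℚ.toℚᵘ-homo-* 8ℚ (+ d / 1)) (ℚᵘ.≃-trans
      (ℚᵘ.*-congˡ {ℚ.toℚᵘ 8ℚ} (ℚ.toℚᵘ-fromℚᵘ (mkℚᵘ (+ d) 0)))
      (*≡* (cong (ℤ._* + 1) (sym (ℤ.pos-* 8 d))))))))

-- The family of graphs and its bounds.

emptyGraph : ∀ N → Graph N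
emptyGraph N = record
  { Node     = Fin N
  ; index    = ↔-id (Fin N)
  ; _~_      = λ _ _ → ⊥
  ; _~?_     = λ _ _ → no λ ()
  ; ~-sym    = λ ()
  ; ~-irrefl = λ ()
  }

emptyGraph-edgeless : ∀ N → ¬ Graph.Edge (emptyGraph N)
emptyGraph-edgeless N e = proj₂ (GraphProperties.ends-oriented (emptyGraph N) e)

-- 2p factors only as a strip of width at most 2.
data TwicePrime : ℕ → Set where
  twicePrime : ∀ m → 11 ≤ m → Prime (suc m) → TwicePrime (2 * suc m)

twicePrime? : ∀ N → Dec (TwicePrime N)
twicePrime? N = map′ (λ (N≡ , 12≤c , prime-c) → build (N ℕ./ 2) N≡ 12≤c prime-c) unbuild
  ((N ℕ.≟ 2 * (N ℕ./ 2)) ×-dec ((12 ℕ.≤? (N ℕ./ 2)) ×-dec prime? (N ℕ./ 2)))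
  where
  build : ∀ {N} c → N ≡ 2 * c → 12 ≤ c → Prime c → TwicePrime N
  build (suc m) refl (s≤s 11≤m) prime-c = twicePrime m 11≤m prime-c

  unbuild : ∀ {N} → TwicePrime N → N ≡ 2 * (N ℕ./ 2) × 12 ≤ N ℕ./ 2 × Prime (N ℕ./ 2)
  unbuild (twicePrime m 11≤m prime-c) =
    subst (λ c → 2 * suc m ≡ 2 * c × 12 ≤ c × Prime c) (sym (trans (cong (ℕ._/ 2) (ℕ.*-comm 2 (suc m))) (m*n/n≡m (suc m) 2)))
      (refl , s≤s 11≤m , prime-c)

-- The decision is an argument so that proofs can match on it. For other N the graph is edgeless:
-- every embedding has congestion 0, and bounds assuming congestion 1 hold vacuously.
graphFor : ∀ {N} → Dec (TwicePrime N) → Graph N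
graphFor     (yes (twicePrime m 11≤m _)) = Clamp.clamp m 11≤m
graphFor {N} (no _)                      = emptyGraph N

N≤8*dilation : ∀ {N} (d : Dec (TwicePrime N)) ℓ₁ ℓ₂ .{{_ : NonZero ℓ₁}} .{{_ : NonZero ℓ₂}} →
  ℓ₁ * ℓ₂ ≡ N → (E : Embedding (graphFor d) (grid ℓ₁ ℓ₂)) → edgeCongestion E ≡ 1 → N ≤ 8 * dilation E
N≤8*dilation {N} (no _) _ _ _ E congestion≡1 = contradiction congestion≡1 λ eq →
  case trans (sym (EmbeddingProperties.edgeless⇒congestion≡0 E (emptyGraph-edgeless N))) eq of λ ()
N≤8*dilation (yes (twicePrime m 11≤m prime-c)) ℓ₁ ℓ₂ size E congestion≡1 = begin
  2 * suc m             ≤⟨ ℕ.*-monoʳ-≤ 2 (columns≤4*dilation m 11≤m strip E congestion≡1) ⟩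
  2 * (4 * dilation E)  ≡⟨ ℕ.*-assoc 2 4 (dilation E) ⟨
  8 * dilation E        ∎
  where
  open ℕ.≤-Reasoning

  strip : Strip (grid ℓ₁ ℓ₂)
  strip = [ gridStrip ℓ₁ ℓ₂ , gridStripᵀ ℓ₁ ℓ₂ ]′ (2*prime-factor prime-c ℓ₁ ℓ₂ size)

embeddable : ∀ {N} (d : Dec (TwicePrime N)) → TwicePrime N →
  ∃₂ λ (ℓ₁ ℓ₂ : ℕ) → Σ (NonZero ℓ₁) λ nz₁ → Σ (NonZero ℓ₂) λ nz₂ →
  ℓ₁ * ℓ₂ ≡ N ×
  Σ (Embedding (graphFor d) (grid ℓ₁ ℓ₂ {{nz₁}} {{nz₂}})) λ E → edgeCongestion E ≡ 1
embeddable (no ¬p) p = contradiction p ¬p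
embeddable (yes (twicePrime m 11≤m _)) _ =
  2 , suc m , _ , _ , refl , Clamp.clampEmbedding m 11≤m , Clamp.clampEmbedding-congestion m 11≤m

-- For some N no embedding has congestion 1. The last component therefore supplies such embeddings
-- for arbitrarily large N, so that the two-sided bound is not vacuous.
theorem4 : Σ ((N : ℕ) → Graph N) λ G →
    (∃₂ λ (c₁ c₂ : ℚ) → 0ℚ ℚ.< c₁ × 0ℚ ℚ.< c₂ × ∃ λ (N₀ : ℕ) →
    ∀ (N : ℕ) → N₀ ≤ N →
    ∀ (ℓ₁ ℓ₂ : ℕ) .{{_ : NonZero ℓ₁}} .{{_ : NonZero ℓ₂}} → ℓ₁ * ℓ₂ ≡ N →
    ∀ (E : Embedding (G N) (grid ℓ₁ ℓ₂)) → edgeCongestion E ≡ 1 →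
    c₁ ℚ.* (+ N / 1) ℚ.≤ (+ dilation E / 1)
    × (+ dilation E / 1) ℚ.≤ c₂ ℚ.* (+ N / 1))
    × (∀ (M : ℕ) → ∃ λ (N : ℕ) → M ≤ N ×
    ∃₂ λ (ℓ₁ ℓ₂ : ℕ) → Σ (NonZero ℓ₁) λ nz₁ → Σ (NonZero ℓ₂) λ nz₂ →
    ℓ₁ * ℓ₂ ≡ N ×
    Σ (Embedding (G N) (grid ℓ₁ ℓ₂ {{nz₁}} {{nz₂}})) λ E → edgeCongestion E ≡ 1)
theorem4 = (λ N → graphFor (twicePrime? N)) ,
  -- The constant 1/8 comes from `N≤8*dilation`: a factor 4 for the columns and 2 for the rows. The
  -- constant 1 is the bound on path lengths by the number of nodes.
  (+ 1 / 8 , 1ℚ , ℚ.positive⁻¹ (+ 1 / 8) , ℚ.positive⁻¹ 1ℚ , 0 ,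
    λ N _ ℓ₁ ℓ₂ size E congestion≡1 →
      ⅛*≤ {d = dilation E} (N≤8*dilation (twicePrime? N) ℓ₁ ℓ₂ size E congestion≡1) ,
      subst (+ dilation E / 1 ℚ.≤_) (sym (ℚ.*-identityˡ (+ N / 1)))
        (/1-mono-≤ {dilation E} (subst (dilation E ≤_) size (EmbeddingProperties.dilation≤N E)))) ,
  -- A prime above M + 11 gives both m ≥ 11 and 2p ≥ M.
  λ M → arbitrarilyLarge M (unbounded-primes (M + 11))
  where
  arbitrarilyLarge : ∀ M → (∃ λ p → M + 11 < p × Prime p) → _
  arbitrarilyLarge M (suc m , s≤s M+11≤m , prime-p) =
    2 * suc m , M≤ ,
    embeddable (twicePrime? (2 * suc m)) (twicePrime m (ℕ.≤-trans (ℕ.m≤n+m 11 M) M+11≤m) prime-p)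
    where
    M≤ : M ≤ 2 * suc m
    M≤ = ℕ.≤-trans (ℕ.m≤m+n M 11) (ℕ.≤-trans M+11≤m (ℕ.≤-trans (ℕ.n≤1+n m) (ℕ.m≤m+n (suc m) _)))
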